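{- For every fixed integer $k\ge 2$, \[ \lim_{n\rightarrow\infty} m(n,k)\cdot\frac{k(k-1)}{n(n-1)}=1 . \]
   Context: A hypergraph is an ordered pair $(X,H)$ such that $X$ is a set and $H$ is a family of subsets of $X$; elements of $X$ are its vertices and members of $H$ are its edges (edges may have arbitrary sizes). For any two distinct vertices $u,v$ of a hypergraph $(X,H)$, the line $\overline{uv}$ is the set $\{u,v\}\cup\{p\in X:\ \exists\, T\in H \text{ with } \{u,v,p\}\subseteq T\}$. The lines of the hypergraph are all the sets $\overline{uv}$ with $u,v$ distinct vertices; the number of lines is the number of distinct such sets. For integers $n,k$, $m(n,k)$ denotes the smallest number of (distinct) lines in a hypergraph on $n$ vertices where every line consists of at most $k$ vertices. -}

module Defs where

open import Data.Bool using (true)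
open import Data.Bool.Properties using () renaming (_≟_ to _≟ᵇ_)
open import Data.Fin using (Fin)
open import Data.Fin.Properties using (all?) renaming (_≟_ to _≟ᶠ_)
open import Data.Fin.Subset using (Subset; inside; outside; _∈_; ∣_∣; ⁅_⁆; _∪_)
open import Data.Fin.Subset.Properties
  using (_∈?_; ∣⁅x⁆∣≡1; p⊆q⇒∣p∣≤∣q∣; x∈p∪q⁺; x∈⁅x⁆)
open import Data.Integer using (+_)
open import Data.List using (List; []; _∷_; _++_; map; filter; length; deduplicate; allFin; cartesianProduct)
open import Data.List.Extrema.Nat using (argmin; argmin-all; f[argmin]≤f[xs])
open import Data.List.Membership.Propositional using () renaming (_∈_ to _∈ˡ_)
open import Data.List.Membership.Propositional.Properties
  using (∈-map⁺; ∈-++⁺ˡ; ∈-++⁺ʳ; ∈-filter⁺; ∈-filter⁻)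
open import Data.List.Properties using (map-cong)
open import Data.List.Relation.Binary.Subset.Propositional using (_⊆_)
open import Data.List.Relation.Binary.Subset.Propositional.Properties using (Any-resp-⊆)
open import Data.List.Relation.Unary.All using () renaming (lookup to lookupᴬ)
open import Data.List.Relation.Unary.All.Properties using (all-filter)
open import Data.List.Relation.Unary.Any using (Any; here; any?)
open import Data.Nat using (ℕ; zero; suc; _≤_; z≤n; s≤s; _+_; _*_; _∸_)
open import Data.Nat.Properties using (_≤?_; ≤-trans; ≤-reflexive; +-suc; m≤n⇒m≤1+n)
open import Data.Product using (Σ-syntax; ∃-syntax; _×_; _,_; proj₁; proj₂; uncurry)
open import Data.Rational using (ℚ; 0ℚ; _/_) renaming (_*_ to _*ℚ_; _-_ to _-ℚ_; _<_ to _<ℚ_; ∣_∣ to ∣_∣ℚ)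
open import Data.Sum using (_⊎_; inj₁; inj₂)
open import Data.Vec using ([]; _∷_; tabulate)
open import Data.Vec.Properties using (≡-dec; tabulate-cong; lookup∘tabulate; []=⇒lookup; lookup⇒[]=)
open import Function using (_∘_; mk⇔)
open import Relation.Binary.Definitions using (DecidableEquality)
open import Relation.Binary.PropositionalEquality
  using (_≡_; _≢_; refl; sym; trans; cong; cong₂; subst)
open import Relation.Nullary using (Dec; does; yes; no; ¬?)
open import Relation.Nullary.Decidable using (does-⇔; dec-true; _⊎-dec_; _×-dec_; _→-dec_)
open import Relation.Unary using (Decidable)

-- The vertex set is Fin n.  A family of subsets of a finite set is given by
-- listing it; order and repetitions of the edges affect nothing below.
record Hypergraph (n : ℕ) : Set where
  constructor hypergraph
  field
    edges : List (Subset n)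

open Hypergraph public

module _ {n : ℕ} where

  OnLine : Hypergraph n → (u v p : Fin n) → Set
  OnLine H u v p = (p ≡ u ⊎ p ≡ v) ⊎ Any (λ T → u ∈ T × v ∈ T × p ∈ T) (edges H)

  onLine? : ∀ H u v p → Dec (OnLine H u v p)
  onLine? H u v p = ((p ≟ᶠ u) ⊎-dec (p ≟ᶠ v))
    ⊎-dec any? (λ T → (u ∈? T) ×-dec ((v ∈? T) ×-dec (p ∈? T))) (edges H)

  line : Hypergraph n → (u v : Fin n) → Subset n
  line H u v = tabulate (λ p → does (onLine? H u v p))

  ∈line⁺ : ∀ H u v {p} → OnLine H u v p → p ∈ line H u v
  ∈line⁺ H u v {p} o = lookup⇒[]= p (line H u v)
    (trans (lookup∘tabulate _ p) (dec-true (onLine? H u v p) o))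

  ∈line⁻ : ∀ H u v {p} → p ∈ line H u v → OnLine H u v p
  ∈line⁻ H u v {p} p∈ = fromDoes (onLine? H u v p)
    (trans (sym (lookup∘tabulate _ p)) ([]=⇒lookup p∈))
    where
    fromDoes : ∀ {A : Set} (a? : Dec A) → does a? ≡ true → A
    fromDoes (yes a) _ = a

  distinctPairs : List (Fin n × Fin n)
  distinctPairs = filter (λ (u , v) → ¬? (u ≟ᶠ v)) (cartesianProduct (allFin n) (allFin n))

  _≟ˢ_ : DecidableEquality (Subset n)
  _≟ˢ_ = ≡-dec _≟ᵇ_

  lines : Hypergraph n → List (Subset n)
  lines H = deduplicate _≟ˢ_ (map (uncurry (line H)) distinctPairs)

  numLines : Hypergraph n → ℕ
  numLines H = length (lines H)

  LinesAtMost : ℕ → Hypergraph n → Set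
  LinesAtMost k H = ∀ u v → u ≢ v → ∣ line H u v ∣ ≤ k

IsMinNumLines : (n k l : ℕ) → Set
IsMinNumLines n k l =
    (∃[ H ] LinesAtMost {n} k H × numLines H ≡ l)
  × (∀ H → LinesAtMost {n} k H → l ≤ numLines H)

-- The minimum exists: the hypergraph without edges is a candidate when 2 ≤ k,
-- and up to listing there are only finitely many hypergraphs on Fin n.
private
  sublists : ∀ {A : Set} → List A → List (List A)
  sublists []       = [] ∷ []
  sublists (x ∷ xs) = map (x ∷_) (sublists xs) ++ sublists xs

  filter∈sublists : ∀ {A : Set} {P : A → Set} (P? : Decidable P) xs → filter P? xs ∈ˡ sublists xs
  filter∈sublists P? []       = here refl
  filter∈sublists P? (x ∷ xs) with P? x
  ... | yes _ = ∈-++⁺ˡ (∈-map⁺ (x ∷_) (filter∈sublists P? xs))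
  ... | no  _ = ∈-++⁺ʳ (map (x ∷_) (sublists xs)) (filter∈sublists P? xs)

  subsets : ∀ n → List (Subset n)
  subsets zero    = [] ∷ []
  subsets (suc n) = map (inside ∷_) (subsets n) ++ map (outside ∷_) (subsets n)

  ∈subsets : ∀ {n} (T : Subset n) → T ∈ˡ subsets n
  ∈subsets []            = here refl
  ∈subsets (inside ∷ T)  = ∈-++⁺ˡ (∈-map⁺ (inside ∷_) (∈subsets T))
  ∈subsets (outside ∷ T) = ∈-++⁺ʳ (map (inside ∷_) (subsets _)) (∈-map⁺ (outside ∷_) (∈subsets T))

  ∣p∪q∣≤∣p∣+∣q∣ : ∀ {n} (p q : Subset n) → ∣ p ∪ q ∣ ≤ ∣ p ∣ + ∣ q ∣
  ∣p∪q∣≤∣p∣+∣q∣ []            []            = z≤n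
  ∣p∪q∣≤∣p∣+∣q∣ (outside ∷ p) (outside ∷ q) = ∣p∪q∣≤∣p∣+∣q∣ p q
  ∣p∪q∣≤∣p∣+∣q∣ (outside ∷ p) (inside ∷ q)  =
    ≤-trans (s≤s (∣p∪q∣≤∣p∣+∣q∣ p q)) (≤-reflexive (sym (+-suc ∣ p ∣ ∣ q ∣)))
  ∣p∪q∣≤∣p∣+∣q∣ (inside ∷ p)  (outside ∷ q) = s≤s (∣p∪q∣≤∣p∣+∣q∣ p q)
  ∣p∪q∣≤∣p∣+∣q∣ (inside ∷ p)  (inside ∷ q)  =
    s≤s (≤-trans (m≤n⇒m≤1+n (∣p∪q∣≤∣p∣+∣q∣ p q)) (≤-reflexive (sym (+-suc ∣ p ∣ ∣ q ∣))))

  module _ {n : ℕ} where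
    open import Data.List.Membership.DecPropositional (_≟ˢ_ {n}) using () renaming (_∈?_ to _∈ˡ?_)

    hypergraphs : List (Hypergraph n)
    hypergraphs = map hypergraph (sublists (subsets n))

    normalise : Hypergraph n → Hypergraph n
    normalise H = hypergraph (filter (_∈ˡ? edges H) (subsets n))

    normalise∈ : ∀ H → normalise H ∈ˡ hypergraphs
    normalise∈ H = ∈-map⁺ hypergraph (filter∈sublists (_∈ˡ? edges H) (subsets n))

    OnLine-mono : ∀ {H G : Hypergraph n} {u v p} → edges H ⊆ edges G → OnLine H u v p → OnLine G u v p
    OnLine-mono H⊆G (inj₁ e) = inj₁ e
    OnLine-mono H⊆G (inj₂ a) = inj₂ (Any-resp-⊆ H⊆G a)

    line-normalise : ∀ H u v → line (normalise H) u v ≡ line H u v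
    line-normalise H u v = tabulate-cong λ p → does-⇔
      (mk⇔ (OnLine-mono {normalise H} {H} λ x → proj₂ (∈-filter⁻ (_∈ˡ? edges H) {xs = subsets n} x))
           (OnLine-mono {H} {normalise H} λ {T} x → ∈-filter⁺ (_∈ˡ? edges H) (∈subsets T) x))
      (onLine? (normalise H) u v p) (onLine? H u v p)

    numLines-normalise : ∀ H → numLines (normalise H) ≡ numLines H
    numLines-normalise H = cong (length ∘ deduplicate _≟ˢ_)
      (map-cong (λ (u , v) → line-normalise H u v) distinctPairs)

    linesAtMost? : ∀ k → Decidable (LinesAtMost {n} k)
    linesAtMost? k H = all? λ u → all? λ v → ¬? (u ≟ᶠ v) →-dec (∣ line H u v ∣ ≤? k)

    noEdges : Hypergraph n
    noEdges = hypergraph []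

    noEdges-linesAtMost : ∀ {k} → 2 ≤ k → LinesAtMost k noEdges
    noEdges-linesAtMost 2≤k u v _ = ≤-trans (p⊆q⇒∣p∣≤∣q∣ line⊆) (≤-trans (∣p∪q∣≤∣p∣+∣q∣ ⁅ u ⁆ ⁅ v ⁆)
        (≤-trans (≤-reflexive (cong₂ _+_ (∣⁅x⁆∣≡1 u) (∣⁅x⁆∣≡1 v))) 2≤k))
      where
      line⊆ : ∀ {p} → p ∈ line noEdges u v → p ∈ (⁅ u ⁆ ∪ ⁅ v ⁆)
      line⊆ {p} p∈ with ∈line⁻ noEdges u v p∈
      ... | inj₁ (inj₁ refl) = x∈p∪q⁺ (inj₁ (x∈⁅x⁆ p))
      ... | inj₁ (inj₂ refl) = x∈p∪q⁺ (inj₂ (x∈⁅x⁆ p))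

minNumLines : ∀ n k → 2 ≤ k → Σ[ l ∈ ℕ ] IsMinNumLines n k l
minNumLines n k 2≤k = numLines best , (best , best-ok , refl) , best-least
  where
  candidates : List (Hypergraph n)
  candidates = filter (linesAtMost? k) hypergraphs

  best : Hypergraph n
  best = argmin numLines noEdges candidates

  best-ok : LinesAtMost k best
  best-ok = argmin-all numLines (noEdges-linesAtMost 2≤k) (all-filter (linesAtMost? k) hypergraphs)

  best-least : ∀ H → LinesAtMost k H → numLines best ≤ numLines H
  best-least H ok = subst (numLines best ≤_) (numLines-normalise H)
    (lookupᴬ (f[argmin]≤f[xs] {f = numLines} noEdges candidates)
      (∈-filter⁺ (linesAtMost? k) (normalise∈ H)
        λ u v u≢v → subst (λ L → ∣ L ∣ ≤ k) (sym (line-normalise H u v)) (ok u v u≢v)))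

m : ∀ n k → 2 ≤ k → ℕ
m n k 2≤k = proj₁ (minNumLines n k 2≤k)

-- Total quotient, with the junk value 0 for denominator 0; in the limit below
-- the denominator n (n − 1) vanishes only for n ≤ 1.
_/₀_ : ℕ → ℕ → ℚ
a /₀ zero      = 0ℚ
a /₀ b@(suc _) = + a / b

fromℕ : ℕ → ℚ
fromℕ a = + a / 1

-- For a rational sequence with rational limit it is enough to let ε be rational.
_⟶_ : (ℕ → ℚ) → ℚ → Set
a ⟶ L = ∀ (ε : ℚ) → 0ℚ <ℚ ε → ∃[ N ] (∀ n → N ≤ n → ∣ a n -ℚ L ∣ℚ <ℚ ε)

{-# OPTIONS --safe #-}
-- A line of at most k vertices contains at most k (k − 1) ordered pairs, and every pair lies in a line,
-- so m(n,k) ≥ n (n − 1) / (k (k − 1)).  Conversely, for q = 1 + k! s the lines x = a + i b over ℤ/q form a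
-- transversal design with k groups of size q.  Take its blocks as edges, together with a copy of a
-- hypergraph G on q vertices in each group, and add r < k · k! isolated vertices: this gives
-- m(kq + r, k) ≤ q² + k m(q, k) + 2 r n.  Each use of this recursion halves the quadratic term of the
-- excess of k (k − 1) m(n,k) over n².

module Submission where

open import Defs
open import Data.Nat using (ℕ; _≤_; _*_; _∸_)
open import Data.Rational using (1ℚ) renaming (_*_ to _*ℚ_)

open import Data.Nat using (zero; suc; _+_; _^_; _!; _<_; z≤n; s≤s; NonZero; >-nonZero)
open import Data.Nat.DivMod using (_/_; _%_; m≡m%n+[m/n]*n; m%n<n)
open import Data.Nat.Properties hiding (suc-injective; _≟_)
open import Data.Nat.Tactic.RingSolver using (solve-∀)
open import Data.Integer as ℤ using (ℤ; +_; -[1+_])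
import Data.Integer.Properties as ℤ
open import Data.Rational as ℚ using (0ℚ; mkℚ; toℚᵘ; ↧ₙ_) renaming (_-_ to _-ℚ_; _<_ to _<ℚ_; ∣_∣ to ∣_∣ℚ)
import Data.Rational.Properties as ℚ
open import Data.Rational.Unnormalised using (mkℚᵘ; *≡*; *≤*; *<*; _≃_)
import Data.Rational.Unnormalised.Properties as ℚᵘ
open import Data.Empty using (⊥)
open import Data.Fin using (Fin; zero; suc; toℕ; fromℕ<; punchIn; punchOut; _≟_)
open import Data.Fin.Properties using
  ( injective⇒≤; punchIn-injective; punchInᵢ≢i; punchIn-punchOut; suc-injective
  ; toℕ<n; toℕ-injective; toℕ-fromℕ<; +↔⊎; *↔× )
open import Data.Fin.Subset using (Subset; inside; outside; _∈_; _⊆_; ∣_∣)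
open import Data.Fin.Subset.Properties using (_∈?_; ⊆-antisym)
open import Data.Vec using ([]; _∷_; here; there; tabulate)
open import Data.Vec.Properties using (lookup∘tabulate; []=⇒lookup; lookup⇒[]=)
open import Data.List using
  (List; []; _∷_; _++_; map; length; lookup; concatMap; allFin; cartesianProduct; cartesianProductWith)
open import Data.List.Properties using (length-map; length-++; length-tabulate)
open import Data.List.Membership.Propositional using (find; lose) renaming (_∈_ to _∈ˡ_)
open import Data.List.Membership.Propositional.Properties
open import Data.List.Membership.Setoid.Properties using (index-injective)
open import Data.List.Relation.Binary.Subset.Propositional using () renaming (_⊆_ to _⊆ˡ_)
open import Data.List.Relation.Unary.All as All using ()
open import Data.List.Relation.Unary.AllPairs using ([]; _∷_)
open import Data.List.Relation.Unary.Any as Any using (here; there; index)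
open import Data.List.Relation.Unary.Any.Properties using (lookup-index)
open import Data.List.Relation.Unary.Unique.Propositional using (Unique)
open import Data.List.Relation.Unary.Unique.Propositional.Properties as Unique using (allFin⁺)
open import Data.List.Relation.Unary.Unique.DecPropositional.Properties using (deduplicate-!)
open import Data.Product using (∃; ∃₂; ∃-syntax; _×_; _,_; proj₁; proj₂; uncurry)
open import Data.Product.Properties using (,-injective)
open import Data.Sum using (_⊎_; inj₁; inj₂)
open import Data.Sum.Function.Propositional using (_⊎-↔_)
open import Function using (_↔_; Inverse; _∘_)
open import Function.Construct.Composition using (_↔-∘_)
open import Function.Construct.Identity using (↔-id)
open import Relation.Binary.PropositionalEquality hiding (J)
open import Relation.Nullary using (¬_; yes; no; does; contradiction)
open import Relation.Nullary.Decidable using (dec-true; _×-dec_)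
open import Relation.Unary using (Decidable)

private
  variable
    n k : ℕ

-- Counting in duplicate-free lists and finite subsets.

lookup-injective : {A : Set} {xs : List A} → Unique xs → ∀ {i j} → lookup xs i ≡ lookup xs j → i ≡ j
lookup-injective (_ ∷ _)  {zero}  {zero}  _  = refl
lookup-injective (x∉ ∷ _) {zero}  {suc j} eq = contradiction eq (All.lookup x∉ (∈-lookup j))
lookup-injective (x∉ ∷ _) {suc i} {zero}  eq = contradiction (sym eq) (All.lookup x∉ (∈-lookup i))
lookup-injective (_ ∷ u)  {suc i} {suc j} eq = cong suc (lookup-injective u eq)

-- Sending a position of `xs` to the position where its entry is found in `ys` is injective because
-- `xs` has no repetitions; the pigeonhole principle does the rest.
length-mono-⊆ : {A : Set} {xs ys : List A} → Unique xs → xs ⊆ˡ ys → length xs ≤ length ys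
length-mono-⊆ {xs = xs} u xs⊆ys = injective⇒≤ {f = λ i → index (xs⊆ys (∈-lookup {xs = xs} i))}
  λ {i} {j} eq → lookup-injective u (index-injective (setoid _) (xs⊆ys (∈-lookup i)) (xs⊆ys (∈-lookup j)) eq)

length-cartesianProductWith : ∀ {A B C : Set} (f : A → B → C) xs ys →
  length (cartesianProductWith f xs ys) ≡ length xs * length ys
length-cartesianProductWith f []       ys = refl
length-cartesianProductWith f (x ∷ xs) ys = trans (length-++ (map (f x) ys))
  (cong₂ _+_ (length-map (f x) ys) (length-cartesianProductWith f xs ys))

length-allFin : ∀ n → length (allFin n) ≡ n
length-allFin n = length-tabulate {n = n} (λ i → i)

length-concatMap≤ : ∀ {A B : Set} (f : A → List B) c xs → (∀ {x} → x ∈ˡ xs → length (f x) ≤ c) →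
  length (concatMap f xs) ≤ length xs * c
length-concatMap≤ f c []       _  = z≤n
length-concatMap≤ f c (x ∷ xs) le = ≤-trans (≤-reflexive (length-++ (f x)))
  (+-mono-≤ (le (here refl)) (length-concatMap≤ f c xs (λ x∈ → le (there x∈))))

elements : Subset n → List (Fin n)
elements []            = []
elements (inside ∷ S)  = zero ∷ map suc (elements S)
elements (outside ∷ S) = map suc (elements S)

length-elements : (S : Subset n) → length (elements S) ≡ ∣ S ∣
length-elements []            = refl
length-elements (inside ∷ S)  = cong suc (trans (length-map Fin.suc (elements S)) (length-elements S))
length-elements (outside ∷ S) = trans (length-map Fin.suc (elements S)) (length-elements S)

∈-elements⁺ : {S : Subset n} {x : Fin n} → x ∈ S → x ∈ˡ elements S
∈-elements⁺ {S = inside ∷ _}  here       = here refl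
∈-elements⁺ {S = inside ∷ _}  (there x∈) = there (∈-map⁺ suc (∈-elements⁺ x∈))
∈-elements⁺ {S = outside ∷ _} (there x∈) = ∈-map⁺ suc (∈-elements⁺ x∈)

∈-elements⁻ : {S : Subset n} {x : Fin n} → x ∈ˡ elements S → x ∈ S
∈-elements⁻ {S = inside ∷ S}  (here refl) = here
∈-elements⁻ {S = inside ∷ S}  (there x∈) with _ , y∈ , refl ← ∈-map⁻ suc x∈ = there (∈-elements⁻ y∈)
∈-elements⁻ {S = outside ∷ S} x∈         with _ , y∈ , refl ← ∈-map⁻ suc x∈ = there (∈-elements⁻ y∈)

elements-! : (S : Subset n) → Unique (elements S)
elements-! []            = []
elements-! (inside ∷ S)  = All.tabulate (λ { x∈ refl → zero∉ (∈-map⁻ suc x∈) })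
  ∷ Unique.map⁺ suc-injective (elements-! S)
  where
  zero∉ : ¬ (∃ λ x → x ∈ˡ elements S × zero ≡ suc x)
  zero∉ (_ , _ , ())
elements-! (outside ∷ S) = Unique.map⁺ suc-injective (elements-! S)

∣∣≤length : (S : Subset n) (xs : List (Fin n)) → (∀ {x} → x ∈ S → x ∈ˡ xs) → ∣ S ∣ ≤ length xs
∣∣≤length S xs S⊆xs = subst (_≤ length xs) (length-elements S)
  (length-mono-⊆ (elements-! S) (λ x∈ → S⊆xs (∈-elements⁻ x∈)))

-- Built with `punchIn`, which skips the value `i`, so that the length is read off a product and no
-- filtered list has to be counted.
offDiagonal : ∀ n → List (Fin n × Fin n)
offDiagonal zero    = []
offDiagonal (suc n) = map (λ (i , j) → i , punchIn i j) (cartesianProduct (allFin (suc n)) (allFin n))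

length-offDiagonal : ∀ n → length (offDiagonal n) ≡ n * (n ∸ 1)
length-offDiagonal zero    = refl
length-offDiagonal (suc n) = trans (length-map _ (cartesianProduct (allFin (suc n)) (allFin n)))
  (trans (length-cartesianProductWith _,_ (allFin (suc n)) (allFin n)) (cong₂ _*_ (length-allFin (suc n)) (length-allFin n)))

offDiagonal-! : ∀ n → Unique (offDiagonal n)
offDiagonal-! zero    = []
offDiagonal-! (suc n) = Unique.map⁺ inj (Unique.cartesianProduct⁺ (allFin⁺ (suc n)) (allFin⁺ n))
  where
  inj : ∀ {p q : Fin (suc n) × Fin n} → (proj₁ p , punchIn (proj₁ p) (proj₂ p)) ≡ (proj₁ q , punchIn (proj₁ q) (proj₂ q)) → p ≡ q
  inj {i , j} {i′ , j′} eq with refl , eq′ ← ,-injective eq = cong (i ,_) (punchIn-injective i j j′ eq′)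

∈-offDiagonal⁺ : ∀ {n} {i j : Fin n} → i ≢ j → (i , j) ∈ˡ offDiagonal n
∈-offDiagonal⁺ {suc n} {i} {j} i≢j = subst (λ j′ → (i , j′) ∈ˡ offDiagonal (suc n)) (punchIn-punchOut i≢j)
  (∈-map⁺ _ (∈-cartesianProduct⁺ (∈-allFin i) (∈-allFin (punchOut i≢j))))

∈-offDiagonal⁻ : ∀ {n} {i j : Fin n} → (i , j) ∈ˡ offDiagonal n → i ≢ j
∈-offDiagonal⁻ {suc n} ij∈ refl with (i , j) , _ , eq ← ∈-map⁻ _ ij∈ with refl , eq′ ← ,-injective eq
  = punchInᵢ≢i i j (sym eq′)

-- Listing lines, and the lower bound by counting pairs.

∈-distinctPairs⁺ : {u v : Fin n} → u ≢ v → (u , v) ∈ˡ distinctPairs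
∈-distinctPairs⁺ {u = u} {v} u≢v =
  ∈-filter⁺ _ (∈-cartesianProduct⁺ (∈-allFin u) (∈-allFin v)) u≢v

line∈lines : (H : Hypergraph n) {u v : Fin n} → u ≢ v → line H u v ∈ˡ lines H
line∈lines H u≢v = ∈-deduplicate⁺ _≟ˢ_ (∈-map⁺ (uncurry (line H)) (∈-distinctPairs⁺ u≢v))

∈lines⁻ : (H : Hypergraph n) {L : Subset n} → L ∈ˡ lines H → ∃₂ λ u v → u ≢ v × L ≡ line H u v
∈lines⁻ H L∈ with (u , v) , uv∈ , refl ← ∈-map⁻ (uncurry (line H)) (∈-deduplicate⁻ _≟ˢ_ _ L∈)
  = u , v , proj₂ (∈-filter⁻ _ {xs = cartesianProduct (allFin _) (allFin _)} uv∈) , refl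

-- Every upper bound on the number of lines comes from here. The list `Ls` may have repetitions and
-- entries that are not lines.
numLines≤length : (H : Hypergraph n) (Ls : List (Subset n)) →
  (∀ u v → u ≢ v → line H u v ∈ˡ Ls) → numLines H ≤ length Ls
numLines≤length H Ls all∈ = length-mono-⊆ (deduplicate-! _≟ˢ_ _) λ L∈ →
  let u , v , u≢v , L≡ = ∈lines⁻ H L∈ in subst (_∈ˡ Ls) (sym L≡) (all∈ u v u≢v)

numLines≤n*n : (H : Hypergraph n) → numLines H ≤ n * n
numLines≤n*n {n} H = subst (numLines H ≤_)
  (trans (length-cartesianProductWith (line H) (allFin n) (allFin n)) (cong₂ _*_ (length-allFin n) (length-allFin n)))
  (numLines≤length H (cartesianProductWith (line H) (allFin n) (allFin n))
    (λ u v _ → ∈-cartesianProductWith⁺ (line H) (∈-allFin u) (∈-allFin v)))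

-- Since `elements S` has no repetitions, pairs of distinct members correspond to pairs of distinct
-- positions, which `offDiagonal` already counts.
pairsIn : Subset n → List (Fin n × Fin n)
pairsIn S = map (λ (i , j) → lookup (elements S) i , lookup (elements S) j) (offDiagonal (length (elements S)))

length-pairsIn : (S : Subset n) → length (pairsIn S) ≡ ∣ S ∣ * (∣ S ∣ ∸ 1)
length-pairsIn S = trans (length-map _ (offDiagonal (length (elements S))))
  (trans (length-offDiagonal (length (elements S))) (cong (λ l → l * (l ∸ 1)) (length-elements S)))

∈-pairsIn⁺ : {S : Subset n} {u v : Fin n} → u ∈ S → v ∈ S → u ≢ v → (u , v) ∈ˡ pairsIn S
∈-pairsIn⁺ {S = S} u∈S v∈S u≢v = subst (_∈ˡ pairsIn S)
  (sym (cong₂ _,_ (lookup-index u∈) (lookup-index v∈)))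
  (∈-map⁺ _ (∈-offDiagonal⁺ λ eq → u≢v (index-injective (setoid _) u∈ v∈ eq)))
  where
  u∈ = ∈-elements⁺ u∈S
  v∈ = ∈-elements⁺ v∈S

numLines-lower : (H : Hypergraph n) → LinesAtMost k H → n * (n ∸ 1) ≤ numLines H * (k * (k ∸ 1))
numLines-lower {n} {k} H H≤k = begin
  n * (n ∸ 1)                          ≡⟨ length-offDiagonal n ⟨
  length (offDiagonal n)               ≤⟨ length-mono-⊆ (offDiagonal-! n) covered ⟩
  length (concatMap pairsIn (lines H)) ≤⟨ length-concatMap≤ pairsIn _ (lines H) small ⟩
  numLines H * (k * (k ∸ 1))           ∎
  where
  open ≤-Reasoning
  covered : offDiagonal n ⊆ˡ concatMap pairsIn (lines H)
  covered {u , v} uv∈ = ∈-concatMap⁺ pairsIn (Any.map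
    (λ { refl → ∈-pairsIn⁺ (∈line⁺ H u v (inj₁ (inj₁ refl))) (∈line⁺ H u v (inj₁ (inj₂ refl))) u≢v })
    (line∈lines H u≢v))
    where u≢v = ∈-offDiagonal⁻ uv∈
  small : ∀ {L} → L ∈ˡ lines H → length (pairsIn L) ≤ k * (k ∸ 1)
  small L∈ with u , v , u≢v , refl ← ∈lines⁻ H L∈ = begin
    length (pairsIn (line H u v))               ≡⟨ length-pairsIn (line H u v) ⟩
    ∣ line H u v ∣ * (∣ line H u v ∣ ∸ 1)       ≤⟨ *-mono-≤ (H≤k u v u≢v) (∸-monoˡ-≤ 1 (H≤k u v u≢v)) ⟩
    k * (k ∸ 1)                                 ∎

-- value t i is the point of the i-th group lying on block t; the q² blocks are indexed by pairs.
record TransversalDesign (k q : ℕ) : Set where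
  field
    value         : Fin q × Fin q → Fin k → Fin q
    block-through : ∀ {i j} → i ≢ j → ∀ x y → ∃ λ t → value t i ≡ x × value t j ≡ y
    block-unique  : ∀ {i j} → i ≢ j → ∀ t t′ → value t i ≡ value t′ i → value t j ≡ value t′ j → t ≡ t′

-- Linear congruences and the transversal design of lines modulo q.

module ModularLines where

  open import Data.Integer using (_-_; -_; 0ℤ; 1ℤ) renaming (_+_ to _+ᶻ_; _*_ to _*ᶻ_)
  open import Data.Integer.DivMod using (_%ℕ_; _/ℕ_; n%ℕd<d; a≡a%ℕn+[a/ℕn]*n)
  open import Data.Integer.Divisibility.Signed
  import Data.Integer.Tactic.RingSolver as ℤ-Solver
  import Data.Nat.Divisibility as ℕ∣

  -- Congruence modulo q is written q ∣ x - y.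
  congruent-trans : ∀ {q} x y z → q ∣ x - y → q ∣ y - z → q ∣ x - z
  congruent-trans {q} x y z p p′ = subst (q ∣_) (identity x y z) (∣m∣n⇒∣m+n p p′)
    where
    identity : ∀ x y z → (x - y) +ᶻ (y - z) ≡ x - z
    identity = ℤ-Solver.solve-∀

  congruent-sym : ∀ {q} x y → q ∣ x - y → q ∣ y - x
  congruent-sym {q} x y p = subst (q ∣_) (identity x y) (∣m⇒∣-m p)
    where
    identity : ∀ x y → - (x - y) ≡ y - x
    identity = ℤ-Solver.solve-∀

  ∣⇒≡0 : ∀ {q z} → + q ∣ z → ℤ.∣ z ∣ < q → z ≡ 0ℤ
  ∣⇒≡0 {q} {z} q∣z z<q with ℤ.∣ z ∣ in eq | ∣⇒∣ᵤ q∣z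
  ... | zero  | _   = ℤ.∣i∣≡0⇒i≡0 eq
  ... | suc _ | q∣s = contradiction (ℕ∣.∣⇒≤ q∣s) (<⇒≱ z<q)

  residue : ∀ {q} → Fin q → ℤ
  residue x = + toℕ x

  ∣a-b∣<c : ∀ {a b c} → a < c → b < c → ℤ.∣ + a - + b ∣ < c
  ∣a-b∣<c {a} {b} a<c b<c = subst (_< _) (sym (cong ℤ.∣_∣ (ℤ.[+m]-[+n]≡m⊖n a b)))
    (<-≤-trans (s≤s (ℤ.∣m⊝n∣≤m⊔n a b)) (⊔-lub a<c b<c))

  -- Two residues differ by less than q in absolute value, and 0 is the only multiple of q that
  -- small.
  residue-injective : ∀ {q} {x y : Fin q} → + q ∣ residue x - residue y → x ≡ y
  residue-injective {x = x} {y} q∣ = toℕ-injective (ℤ.+-injective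
    (ℤ.i-j≡0⇒i≡j _ _ (∣⇒≡0 q∣ (∣a-b∣<c (toℕ<n x) (toℕ<n y)))))

  module _ {q : ℕ} .{{_ : NonZero q}} where

    reduce : ℤ → Fin q
    reduce z = fromℕ< (n%ℕd<d z q)

    reduce-congruent : ∀ z → + q ∣ z - residue (reduce z)
    reduce-congruent z = divides (z /ℕ q) (trans
      (cong (λ r → z - + r) (toℕ-fromℕ< (n%ℕd<d z q)))
      (trans (cong (λ y → y - + (z %ℕ q)) (a≡a%ℕn+[a/ℕn]*n z q)) (identity (+ (z %ℕ q)) (z /ℕ q *ᶻ + q))))
      where
      identity : ∀ r m → (r +ᶻ m) - r ≡ m
      identity = ℤ-Solver.solve-∀

    reduce-≡ : ∀ z {x : Fin q} → + q ∣ z - residue x → reduce z ≡ x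
    reduce-≡ z {x} p = residue-injective (congruent-trans (residue (reduce z)) z (residue x)
      (congruent-sym z (residue (reduce z)) (reduce-congruent z)) p)

    reduce-≡⁻ : ∀ z z′ → reduce z ≡ reduce z′ → + q ∣ z - z′
    reduce-≡⁻ z z′ eq = congruent-trans z (residue (reduce z)) z′ (reduce-congruent z)
      (subst (λ x → + q ∣ residue x - z′) (sym eq) (congruent-sym z′ (residue (reduce z′)) (reduce-congruent z′)))

  d∣k! : ∀ {d k} → 0 < d → d ≤ k → d ℕ∣.∣ k !
  d∣k! {suc d} _ d≤k = ℕ∣.∣-trans (ℕ∣.m∣m*n (d !)) (ℕ∣.m≤n⇒m!∣n! d≤k)

  -- The difference d = i - j is nonzero and smaller than k in absolute value, so it divides k!, say
  -- k! = e d. For q = 1 + k! s this gives d · (- e s) - 1 = - q, hence - e s inverts d modulo q.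
  inverse-mod : ∀ k s {i j : Fin k} → i ≢ j →
    ∃ λ w → + suc (k ! * s) ∣ (residue i - residue j) *ᶻ w - 1ℤ
  inverse-mod k s {i} {j} i≢j with ∣ᵤ⇒∣ {residue i - residue j} {+ (k !)} (d∣k! 0<d (<⇒≤ (∣a-b∣<c (toℕ<n i) (toℕ<n j))))
    where
    0<d : 0 < ℤ.∣ residue i - residue j ∣
    0<d = n≢0⇒n>0 λ eq → i≢j (toℕ-injective (ℤ.+-injective (ℤ.i-j≡0⇒i≡j _ _ (ℤ.∣i∣≡0⇒i≡0 eq))))
  ... | divides e k!≡ = - (e *ᶻ + s) , divides (- 1ℤ) (begin
    d *ᶻ - (e *ᶻ + s) - 1ℤ           ≡⟨ identity d e (+ s) ⟩
    - 1ℤ *ᶻ (1ℤ +ᶻ e *ᶻ d *ᶻ + s)    ≡⟨ cong (λ m → - 1ℤ *ᶻ (1ℤ +ᶻ m *ᶻ + s)) k!≡ ⟨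
    - 1ℤ *ᶻ (1ℤ +ᶻ + (k !) *ᶻ + s)   ≡⟨ cong (λ m → - 1ℤ *ᶻ (1ℤ +ᶻ m)) (ℤ.pos-* (k !) s) ⟨
    - 1ℤ *ᶻ + suc (k ! * s)          ∎)
    where
    open ≡-Reasoning
    d = residue i - residue j
    identity : ∀ d e s → d *ᶻ - (e *ᶻ s) - 1ℤ ≡ - 1ℤ *ᶻ (1ℤ +ᶻ e *ᶻ d *ᶻ s)
    identity = ℤ-Solver.solve-∀

  module _ {k q : ℕ} .{{_ : NonZero q}}
    (invertible : ∀ {i j : Fin k} → i ≢ j → ∃ λ w → + q ∣ (residue i - residue j) *ᶻ w - 1ℤ) where

    -- Block `(a , b)` is the graph of i ↦ a + i b modulo q. Prescribing its values in groups i and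
    -- j gives two linear equations in a and b whose determinant is, up to sign, the invertible
    -- number i - j.
    transversalDesign : TransversalDesign k q
    transversalDesign = record
      { value         = value
      ; block-through = through
      ; block-unique  = unique
      }
      where
      value : Fin q × Fin q → Fin k → Fin q
      value (a , b) i = reduce (residue a +ᶻ residue i *ᶻ residue b)
      through : ∀ {i j : Fin k} → i ≢ j → ∀ (x y : Fin q) → ∃ λ (t : Fin q × Fin q) → value t i ≡ x × value t j ≡ y
      through {i} {j} i≢j x y with w , q∣ ← invertible i≢j =
        (reduce A , reduce B) , reduce-≡ (A′ +ᶻ I *ᶻ B′) at-i , reduce-≡ (A′ +ᶻ J *ᶻ B′) at-j
        where
        I = residue i
        J = residue j
        X = residue x
        Y = residue y
        -- `B` is the slope of the line through the two points, with `w` in place of division by i -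
        -- j; `A` then solves the equation in group i exactly. Reducing both modulo q changes them
        -- by multiples of q only.
        B = w *ᶻ (X - Y)
        A = X - I *ᶻ B
        A′ = residue (reduce {q} A)
        B′ = residue (reduce {q} B)
        q∣A = reduce-congruent {q} A
        q∣B = reduce-congruent {q} B
        at-i : + q ∣ (A′ +ᶻ I *ᶻ B′) - X
        at-i = subst (+ q ∣_) (identity X I B A′ B′) (∣m⇒∣-m (∣m∣n⇒∣m+n q∣A (∣n⇒∣m*n I q∣B)))
          where
          identity : ∀ X I B A′ B′ → - (((X - I *ᶻ B) - A′) +ᶻ I *ᶻ (B - B′)) ≡ (A′ +ᶻ I *ᶻ B′) - X
          identity = ℤ-Solver.solve-∀
        at-j : + q ∣ (A′ +ᶻ J *ᶻ B′) - Y
        at-j = subst (+ q ∣_) (identity X Y I J w A′ B′)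
          (∣m⇒∣-m (∣m∣n⇒∣m+n (∣m∣n⇒∣m+n q∣A (∣n⇒∣m*n J q∣B)) (∣n⇒∣m*n (X - Y) q∣)))
          where
          identity : ∀ X Y I J w A′ B′ →
            - ((((X - I *ᶻ (w *ᶻ (X - Y))) - A′) +ᶻ J *ᶻ (w *ᶻ (X - Y) - B′)) +ᶻ (X - Y) *ᶻ ((I - J) *ᶻ w - 1ℤ)) ≡ (A′ +ᶻ J *ᶻ B′) - Y
          identity = ℤ-Solver.solve-∀
      unique : ∀ {i j : Fin k} → i ≢ j → ∀ (t t′ : Fin q × Fin q) → value t i ≡ value t′ i → value t j ≡ value t′ j → t ≡ t′
      unique {i} {j} i≢j (a , b) (a′ , b′) eqᵢ eqⱼ with w , q∣ ← invertible i≢j =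
        cong₂ _,_ (residue-injective q∣A) (residue-injective q∣B)
        where
        I = residue i
        J = residue j
        A = residue a
        B = residue b
        A′ = residue a′
        B′ = residue b′
        q∣i : + q ∣ (A +ᶻ I *ᶻ B) - (A′ +ᶻ I *ᶻ B′)
        q∣i = reduce-≡⁻ (A +ᶻ I *ᶻ B) (A′ +ᶻ I *ᶻ B′) eqᵢ
        q∣j : + q ∣ (A +ᶻ J *ᶻ B) - (A′ +ᶻ J *ᶻ B′)
        q∣j = reduce-≡⁻ (A +ᶻ J *ᶻ B) (A′ +ᶻ J *ᶻ B′) eqⱼ
        -- Subtracting the two congruences eliminates a and leaves (i - j)(b - b′); multiplying by
        -- `w` cancels i - j.
        q∣B : + q ∣ B - B′
        q∣B = subst (+ q ∣_) (identity A B A′ B′ I J w)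
          (∣m∣n⇒∣m-n (∣n⇒∣m*n w (∣m∣n⇒∣m-n q∣i q∣j)) (∣n⇒∣m*n (B - B′) q∣))
          where
          identity : ∀ A B A′ B′ I J w →
            w *ᶻ (((A +ᶻ I *ᶻ B) - (A′ +ᶻ I *ᶻ B′)) - ((A +ᶻ J *ᶻ B) - (A′ +ᶻ J *ᶻ B′))) - (B - B′) *ᶻ ((I - J) *ᶻ w - 1ℤ) ≡ B - B′
          identity = ℤ-Solver.solve-∀
        q∣A : + q ∣ A - A′
        q∣A = subst (+ q ∣_) (identity A B A′ B′ I) (∣m∣n⇒∣m-n q∣i (∣n⇒∣m*n I q∣B))
          where
          identity : ∀ A B A′ B′ I → ((A +ᶻ I *ᶻ B) - (A′ +ᶻ I *ᶻ B′)) - I *ᶻ (B - B′) ≡ A - A′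
          identity = ℤ-Solver.solve-∀

open ModularLines using (inverse-mod; transversalDesign)

-- Extending a hypergraph by a transversal design.

subset : {P : Fin n → Set} → Decidable P → Subset n
subset P? = tabulate (does ∘ P?)

module _ {P : Fin n → Set} (P? : Decidable P) where

  ∈-subset⁺ : ∀ {x} → P x → x ∈ subset P?
  ∈-subset⁺ {x} px = lookup⇒[]= x (subset P?) (trans (lookup∘tabulate _ x) (dec-true (P? x) px))

  ∈-subset⁻ : ∀ {x} → x ∈ subset P? → P x
  ∈-subset⁻ {x} x∈ with P? x | trans (sym (lookup∘tabulate (does ∘ P?) x)) ([]=⇒lookup x∈)
  ... | yes px | _ = px

-- `inj₁ (i , x)` is point `x` of group `i`; the right summand holds the leftover vertices, which
-- will lie in no edge.
Vertex : (k q r : ℕ) → Set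
Vertex k q r = (Fin k × Fin q) ⊎ Fin r

module Extend {k q r n : ℕ} (D : TransversalDesign k q) (coords : Fin n ↔ Vertex k q r)
              (G : Hypergraph q) (2≤k : 2 ≤ k) (G≤k : LinesAtMost k G) where

  open TransversalDesign D
  open Inverse coords using (to; from; strictlyInverseʳ)

  InBlock : Fin q × Fin q → Vertex k q r → Set
  InBlock t (inj₁ (i , x)) = value t i ≡ x
  InBlock t (inj₂ _)       = ⊥

  InCopy : Fin k → Subset q → Vertex k q r → Set
  InCopy i T (inj₁ (j , x)) = j ≡ i × x ∈ T
  InCopy i T (inj₂ _)       = ⊥

  inBlock? : ∀ t → Decidable (InBlock t)
  inBlock? t (inj₁ (i , x)) = value t i ≟ x
  inBlock? t (inj₂ _)       = no λ ()

  inCopy? : ∀ i T → Decidable (InCopy i T)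
  inCopy? i T (inj₁ (j , x)) = (j ≟ i) ×-dec (x ∈? T)
  inCopy? i T (inj₂ _)       = no λ ()

  block : Fin q × Fin q → Subset n
  block t = subset (inBlock? t ∘ to)

  copy : Fin k → Subset q → Subset n
  copy i T = subset (inCopy? i T ∘ to)

  ∈-block⁺ : ∀ t {p} → InBlock t (to p) → p ∈ block t
  ∈-block⁺ t = ∈-subset⁺ (inBlock? t ∘ to)

  ∈-block⁻ : ∀ t {p} → p ∈ block t → InBlock t (to p)
  ∈-block⁻ t = ∈-subset⁻ (inBlock? t ∘ to)

  ∈-copy⁺ : ∀ i T {p} → InCopy i T (to p) → p ∈ copy i T
  ∈-copy⁺ i T = ∈-subset⁺ (inCopy? i T ∘ to)

  ∈-copy⁻ : ∀ i T {p} → p ∈ copy i T → InCopy i T (to p)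
  ∈-copy⁻ i T = ∈-subset⁻ (inCopy? i T ∘ to)

  blockIndices : List (Fin q × Fin q)
  blockIndices = cartesianProduct (allFin q) (allFin q)

  extension : Hypergraph n
  extension = hypergraph (map block blockIndices ++ cartesianProductWith copy (allFin k) (edges G))

  -- The edge part of `OnLine` for `extension`, split by the two kinds of edges and expressed in
  -- coordinates.
  Common : (u v p : Fin n) → Set
  Common u v p =
      (∃ λ t → InBlock t (to u) × InBlock t (to v) × InBlock t (to p))
    ⊎ (∃₂ λ i T → T ∈ˡ edges G × InCopy i T (to u) × InCopy i T (to v) × InCopy i T (to p))

  ∈line⇒Common : ∀ {u v p} → p ∈ line extension u v → (p ≡ u ⊎ p ≡ v) ⊎ Common u v p
  ∈line⇒Common {u} {v} {p} p∈ with ∈line⁻ extension u v p∈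
  ... | inj₁ eq = inj₁ eq
  ... | inj₂ any with E , E∈ , u∈ , v∈ , p∈E ← find any with ∈-++⁻ (map block blockIndices) E∈
  ...   | inj₁ E∈ with t , _ , refl ← ∈-map⁻ block E∈
          = inj₂ (inj₁ (t , ∈-block⁻ t u∈ , ∈-block⁻ t v∈ , ∈-block⁻ t p∈E))
  ...   | inj₂ E∈ with i , T , _ , T∈ , refl ← ∈-cartesianProductWith⁻ copy (allFin k) (edges G) E∈
          = inj₂ (inj₂ (i , T , T∈ , ∈-copy⁻ i T u∈ , ∈-copy⁻ i T v∈ , ∈-copy⁻ i T p∈E))

  Common⇒∈line : ∀ {u v p} → Common u v p → p ∈ line extension u v
  Common⇒∈line {u} {v} (inj₁ ((a , b) , u∈ , v∈ , p∈)) = ∈line⁺ extension u v (inj₂ (lose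
    (∈-++⁺ˡ (∈-map⁺ block (∈-cartesianProduct⁺ (∈-allFin a) (∈-allFin b))))
    (∈-block⁺ (a , b) u∈ , ∈-block⁺ (a , b) v∈ , ∈-block⁺ (a , b) p∈)))
  Common⇒∈line {u} {v} (inj₂ (i , T , T∈ , u∈ , v∈ , p∈)) = ∈line⁺ extension u v (inj₂ (lose
    (∈-++⁺ʳ (map block blockIndices) (∈-cartesianProductWith⁺ copy (∈-allFin i) T∈))
    (∈-copy⁺ i T u∈ , ∈-copy⁺ i T v∈ , ∈-copy⁺ i T p∈)))

  -- Points of different groups share no copied edge, as each copy stays inside one group, and by
  -- `block-unique` they share only one block.
  line-across : ∀ {u v i j x y t} → to u ≡ inj₁ (i , x) → to v ≡ inj₁ (j , y) → i ≢ j →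
    value t i ≡ x → value t j ≡ y → line extension u v ≡ block t
  line-across {u} {v} {i} {j} {x} {y} {t} u≡ v≡ i≢j tx ty = ⊆-antisym ⊆block block⊆
    where
    u∈ : InBlock t (to u)
    u∈ = subst (InBlock t) (sym u≡) tx
    v∈ : InBlock t (to v)
    v∈ = subst (InBlock t) (sym v≡) ty
    ⊆block : line extension u v ⊆ block t
    ⊆block p∈ with ∈line⇒Common p∈
    ... | inj₁ (inj₁ refl) = ∈-block⁺ t u∈
    ... | inj₁ (inj₂ refl) = ∈-block⁺ t v∈
    ... | inj₂ (inj₁ (t′ , u∈′ , v∈′ , p∈′)) = ∈-block⁺ t (subst (λ t → InBlock t _) t′≡t p∈′)
      where
      t′≡t : t′ ≡ t
      t′≡t = block-unique i≢j t′ t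
        (trans (subst (InBlock t′) u≡ u∈′) (sym tx)) (trans (subst (InBlock t′) v≡ v∈′) (sym ty))
    ... | inj₂ (inj₂ (i′ , T , _ , u∈′ , v∈′ , _)) = contradiction
      (trans (proj₁ (subst (InCopy i′ T) u≡ u∈′)) (sym (proj₁ (subst (InCopy i′ T) v≡ v∈′)))) i≢j
    block⊆ : block t ⊆ line extension u v
    block⊆ p∈ = Common⇒∈line (inj₁ (t , u∈ , v∈ , ∈-block⁻ t p∈))

  -- A block has a single point in each group, so two points of the same group share only copies of
  -- edges of `G`, and their line is the copy of a line of `G`.
  line-within : ∀ {u v i x y} → to u ≡ inj₁ (i , x) → to v ≡ inj₁ (i , y) → x ≢ y →
    line extension u v ≡ copy i (line G x y)
  line-within {u} {v} {i} {x} {y} u≡ v≡ x≢y = ⊆-antisym ⊆copy copy⊆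
    where
    ⊆copy : line extension u v ⊆ copy i (line G x y)
    ⊆copy {p} p∈ with ∈line⇒Common p∈
    ... | inj₁ (inj₁ refl) = ∈-copy⁺ i (line G x y) (subst (InCopy i _) (sym u≡) (refl , ∈line⁺ G x y (inj₁ (inj₁ refl))))
    ... | inj₁ (inj₂ refl) = ∈-copy⁺ i (line G x y) (subst (InCopy i _) (sym v≡) (refl , ∈line⁺ G x y (inj₁ (inj₂ refl))))
    ... | inj₂ (inj₁ (t , u∈ , v∈ , _)) = contradiction
      (trans (sym (subst (InBlock t) u≡ u∈)) (subst (InBlock t) v≡ v∈)) x≢y
    ... | inj₂ (inj₂ (i′ , T , T∈ , u∈ , v∈ , p∈′))
      with refl , x∈ ← subst (InCopy i′ T) u≡ u∈ | _ , y∈ ← subst (InCopy i′ T) v≡ v∈ = ∈-copy⁺ i (line G x y) (enlarge (to p) p∈′)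
      where
      enlarge : ∀ w → InCopy i T w → InCopy i (line G x y) w
      enlarge (inj₁ _) (refl , z∈) = refl , ∈line⁺ G x y (inj₂ (lose T∈ (x∈ , y∈ , z∈)))
    copy⊆ : copy i (line G x y) ⊆ line extension u v
    copy⊆ {p} p∈ = split (to p) refl (∈-copy⁻ i (line G x y) p∈)
      where
      same : ∀ {w w′} → to w ≡ to w′ → w ≡ w′
      same {w} {w′} eq = trans (sym (strictlyInverseʳ w)) (trans (cong from eq) (strictlyInverseʳ w′))
      split : ∀ w → to p ≡ w → InCopy i (line G x y) w → p ∈ line extension u v
      split (inj₁ (_ , z)) p≡ (refl , z∈) with ∈line⁻ G x y z∈
      ... | inj₁ (inj₁ refl) = ∈line⁺ extension u v (inj₁ (inj₁ (same (trans p≡ (sym u≡)))))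
      ... | inj₁ (inj₂ refl) = ∈line⁺ extension u v (inj₁ (inj₂ (same (trans p≡ (sym v≡)))))
      ... | inj₂ any with T , T∈ , x∈ , y∈ , z∈ ← find any
        = Common⇒∈line (inj₂ (i , T , T∈ ,
          subst (InCopy i T) (sym u≡) (refl , x∈) , subst (InCopy i T) (sym v≡) (refl , y∈) , subst (InCopy i T) (sym p≡) (refl , z∈)))

  Isolated : Fin n → Set
  Isolated u = ∃ λ s → to u ≡ inj₂ s

  -- Both the size bound and the count of lines follow this case split. With an isolated end the
  -- line is just the pair of its two vertices.
  data LineShape (u v : Fin n) : Set where
    across : ∀ t → line extension u v ≡ block t → LineShape u v
    within : ∀ i {x y} → x ≢ y → line extension u v ≡ copy i (line G x y) → LineShape u v
    isolated : Isolated u ⊎ Isolated v → LineShape u v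

  lineShape : ∀ {u v} → u ≢ v → LineShape u v
  lineShape {u} {v} u≢v = go (to u) (to v) refl refl
    where
    go : ∀ w w′ → to u ≡ w → to v ≡ w′ → LineShape u v
    go (inj₂ s) _ u≡ _ = isolated (inj₁ (s , u≡))
    go (inj₁ _) (inj₂ s) _ v≡ = isolated (inj₂ (s , v≡))
    go (inj₁ (i , x)) (inj₁ (j , y)) u≡ v≡ with i ≟ j
    ... | no i≢j with t , tx , ty ← block-through i≢j x y = across t (line-across u≡ v≡ i≢j tx ty)
    ... | yes refl = within i x≢y (line-within u≡ v≡ x≢y)
      where
      x≢y : x ≢ y
      x≢y refl = u≢v (trans (sym (strictlyInverseʳ u)) (trans (cong from (trans u≡ (sym v≡))) (strictlyInverseʳ v)))

  -- A block has one point in each of the k groups.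
  ∣block∣≤k : ∀ t → ∣ block t ∣ ≤ k
  ∣block∣≤k t = subst (∣ block t ∣ ≤_) (trans (length-map _ (allFin k)) (length-allFin k))
    (∣∣≤length (block t) (map (λ i → from (inj₁ (i , value t i))) (allFin k)) listed)
    where
    listed : ∀ {p} → p ∈ block t → p ∈ˡ map (λ i → from (inj₁ (i , value t i))) (allFin k)
    listed {p} p∈ = go (to p) refl (∈-block⁻ t p∈)
      where
      go : ∀ w → to p ≡ w → InBlock t w → p ∈ˡ map (λ i → from (inj₁ (i , value t i))) (allFin k)
      go (inj₁ (i , _)) p≡ refl = subst (_∈ˡ map _ (allFin k)) (trans (cong from (sym p≡)) (strictlyInverseʳ p)) (∈-map⁺ _ (∈-allFin i))

  ∣copy∣≤∣∣ : ∀ i T → ∣ copy i T ∣ ≤ ∣ T ∣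
  ∣copy∣≤∣∣ i T = subst (∣ copy i T ∣ ≤_) (trans (length-map _ (elements T)) (length-elements T))
    (∣∣≤length (copy i T) (map (λ x → from (inj₁ (i , x))) (elements T)) listed)
    where
    listed : ∀ {p} → p ∈ copy i T → p ∈ˡ map (λ x → from (inj₁ (i , x))) (elements T)
    listed {p} p∈ = go (to p) refl (∈-copy⁻ i T p∈)
      where
      go : ∀ w → to p ≡ w → InCopy i T w → p ∈ˡ map (λ x → from (inj₁ (i , x))) (elements T)
      go (inj₁ (_ , x)) p≡ (refl , x∈) = subst (_∈ˡ map _ (elements T)) (trans (cong from (sym p≡)) (strictlyInverseʳ p)) (∈-map⁺ _ (∈-elements⁺ x∈))

  no-common : ∀ {u v p} → Isolated u ⊎ Isolated v → Common u v p → ⊥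
  no-common (inj₁ (s , u≡)) (inj₁ (t , u∈ , _))             = subst (InBlock t) u≡ u∈
  no-common (inj₁ (s , u≡)) (inj₂ (i , T , _ , u∈ , _))     = subst (InCopy i T) u≡ u∈
  no-common (inj₂ (s , v≡)) (inj₁ (t , _ , v∈ , _))         = subst (InBlock t) v≡ v∈
  no-common (inj₂ (s , v≡)) (inj₂ (i , T , _ , _ , v∈ , _)) = subst (InCopy i T) v≡ v∈

  linesAtMost : LinesAtMost k extension
  linesAtMost u v u≢v with lineShape u≢v
  ... | across t eq = subst (λ L → ∣ L ∣ ≤ k) (sym eq) (∣block∣≤k t)
  ... | within i x≢y eq = subst (λ L → ∣ L ∣ ≤ k) (sym eq) (≤-trans (∣copy∣≤∣∣ i _) (G≤k _ _ x≢y))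
  ... | isolated iso = ≤-trans (∣∣≤length (line extension u v) (u ∷ v ∷ []) listed) 2≤k
    where
    listed : ∀ {p} → p ∈ line extension u v → p ∈ˡ u ∷ v ∷ []
    listed p∈ with ∈line⇒Common p∈
    ... | inj₁ (inj₁ refl) = here refl
    ... | inj₁ (inj₂ refl) = there (here refl)
    ... | inj₂ c = contradiction c (no-common iso)

  isolatedVertices : List (Fin n)
  isolatedVertices = map (from ∘ inj₂) (allFin r)

  ∈-isolatedVertices : ∀ {u} → Isolated u → u ∈ˡ isolatedVertices
  ∈-isolatedVertices {u} (s , u≡) = subst (_∈ˡ isolatedVertices)
    (trans (cong from (sym u≡)) (strictlyInverseʳ u)) (∈-map⁺ (from ∘ inj₂) (∈-allFin s))

  -- One list per shape: q² blocks, k copies of each line of `G`, and the lines of pairs whose first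
  -- or whose second vertex is isolated, r n pairs of either sort. Overlaps between the lists do no
  -- harm to an upper bound.
  numLines≤ : numLines extension ≤ q * q + (k * numLines G + (r * n + n * r))
  numLines≤ = subst (numLines extension ≤_) count (numLines≤length extension (Bs ++ Cs ++ Is ++ Js) listed)
    where
    Bs Cs Is Js : List (Subset n)
    Bs = map block blockIndices
    Cs = cartesianProductWith copy (allFin k) (lines G)
    Is = cartesianProductWith (line extension) isolatedVertices (allFin n)
    Js = cartesianProductWith (line extension) (allFin n) isolatedVertices
    length-isolated : length isolatedVertices ≡ r
    length-isolated = trans (length-map _ (allFin r)) (length-allFin r)
    count : length (Bs ++ Cs ++ Is ++ Js) ≡ q * q + (k * numLines G + (r * n + n * r))
    count = trans (length-++ Bs) (cong₂ _+_
      (trans (length-map block blockIndices)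
        (trans (length-cartesianProductWith _,_ (allFin q) (allFin q)) (cong₂ _*_ (length-allFin q) (length-allFin q))))
      (trans (length-++ Cs) (cong₂ _+_
        (trans (length-cartesianProductWith copy (allFin k) (lines G)) (cong (_* numLines G) (length-allFin k)))
        (trans (length-++ Is) (cong₂ _+_
          (trans (length-cartesianProductWith (line extension) isolatedVertices (allFin n)) (cong₂ _*_ length-isolated (length-allFin n)))
          (trans (length-cartesianProductWith (line extension) (allFin n) isolatedVertices) (cong₂ _*_ (length-allFin n) length-isolated)))))))
    listed : ∀ u v → u ≢ v → line extension u v ∈ˡ Bs ++ Cs ++ Is ++ Js
    listed u v u≢v with lineShape u≢v
    ... | across (a , b) eq = subst (_∈ˡ _) (sym eq)
          (∈-++⁺ˡ (∈-map⁺ block (∈-cartesianProduct⁺ (∈-allFin a) (∈-allFin b))))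
    ... | within i x≢y eq = subst (_∈ˡ _) (sym eq)
          (∈-++⁺ʳ Bs (∈-++⁺ˡ (∈-cartesianProductWith⁺ copy (∈-allFin i) (line∈lines G x≢y))))
    ... | isolated (inj₁ iso) = ∈-++⁺ʳ Bs (∈-++⁺ʳ Cs (∈-++⁺ˡ
          (∈-cartesianProductWith⁺ (line extension) (∈-isolatedVertices iso) (∈-allFin v))))
    ... | isolated (inj₂ iso) = ∈-++⁺ʳ Bs (∈-++⁺ʳ Cs (∈-++⁺ʳ Is
          (∈-cartesianProductWith⁺ (line extension) (∈-allFin u) (∈-isolatedVertices iso))))

-- The recursion for the upper bound.

vertexCoords : ∀ k q r → Fin (k * q + r) ↔ Vertex k q r
vertexCoords k q r = (*↔× {k} {q} ⊎-↔ ↔-id (Fin r)) ↔-∘ +↔⊎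

k*[k∸1]+k≡k*k : ∀ k → k * (k ∸ 1) + k ≡ k * k
k*[k∸1]+k≡k*k zero    = refl
k*[k∸1]+k≡k*k (suc k) = identity k
  where
  identity : ∀ k → suc k * k + suc k ≡ suc k * suc k
  identity = solve-∀

-- The hypothesis on l reads K l ≤ q² + (K q² + C q) / T. The q² blocks and the main terms of the k
-- copies give K q² + k q² = (k q)² ≤ n². The copies also carry an error k K q² / T, at most K n² /
-- (2 T) because 2 k ≤ k²; this is why T doubles. The leftover vertices cost only a linear term,
-- since r ≤ M.
extension-bound : ∀ {k K q r n T C M l L} → 2 ≤ k → K + k ≡ k * k → k * q + r ≡ n → r ≤ M →
  T * (K * l) ≤ T * (q * q) + (K * (q * q) + C * q) →
  L ≤ q * q + (k * l + (r * n + n * r)) →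
  2 * T * (K * L) ≤ 2 * T * (n * n) + (K * (n * n) + (2 * C + 4 * (T * K * M)) * n)
extension-bound {k} {K} {q} {r} {n} {T} {C} {M} {l} {L} 2≤k K+k kq+r≡n r≤M bound-l bound-L = begin
  2 * T * (K * L)
    ≤⟨ *-monoʳ-≤ (2 * T) (*-monoʳ-≤ K bound-L) ⟩
  2 * T * (K * (q * q + (k * l + (r * n + n * r))))
    ≡⟨ split T K q k l r n ⟩
  2 * T * K * (q * q) + (2 * k * (T * (K * l)) + 4 * (T * K * r) * n)
    ≤⟨ +-monoʳ-≤ (2 * T * K * (q * q)) (+-mono-≤ (*-monoʳ-≤ (2 * k) bound-l)
         (*-monoˡ-≤ n (*-monoʳ-≤ 4 (*-monoʳ-≤ (T * K) r≤M)))) ⟩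
  2 * T * K * (q * q) + (2 * k * (T * (q * q) + (K * (q * q) + C * q)) + 4 * (T * K * M) * n)
    ≡⟨ collect T K q k C M n ⟩
  2 * T * ((K + k) * (q * q)) + (K * (2 * k * (q * q)) + (2 * C * (k * q) + 4 * (T * K * M) * n))
    ≤⟨ +-mono-≤ (*-monoʳ-≤ (2 * T) kkqq≤nn) (+-mono-≤ (*-monoʳ-≤ K 2kqq≤nn) (+-monoˡ-≤ _ (*-monoʳ-≤ (2 * C) kq≤n))) ⟩
  2 * T * (n * n) + (K * (n * n) + (2 * C * n + 4 * (T * K * M) * n))
    ≡⟨ cong (λ x → 2 * T * (n * n) + (K * (n * n) + x)) (*-distribʳ-+ n (2 * C) (4 * (T * K * M))) ⟨
  2 * T * (n * n) + (K * (n * n) + (2 * C + 4 * (T * K * M)) * n) ∎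
  where
  open ≤-Reasoning
  kq≤n : k * q ≤ n
  kq≤n = subst (k * q ≤_) kq+r≡n (m≤m+n (k * q) r)
  square : ∀ k q → k * k * (q * q) ≡ k * q * (k * q)
  square = solve-∀
  kkqq≤nn : (K + k) * (q * q) ≤ n * n
  kkqq≤nn = ≤-trans (≤-reflexive (trans (cong (_* (q * q)) K+k) (square k q))) (*-mono-≤ kq≤n kq≤n)
  2kqq≤nn : 2 * k * (q * q) ≤ n * n
  2kqq≤nn = ≤-trans (*-monoˡ-≤ (q * q) (*-monoˡ-≤ k 2≤k)) (≤-trans (≤-reflexive (square k q)) (*-mono-≤ kq≤n kq≤n))
  split : ∀ T K q k l r n → 2 * T * (K * (q * q + (k * l + (r * n + n * r))))
    ≡ 2 * T * K * (q * q) + (2 * k * (T * (K * l)) + 4 * (T * K * r) * n)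
  split = solve-∀
  collect : ∀ T K q k C M n →
    2 * T * K * (q * q) + (2 * k * (T * (q * q) + (K * (q * q) + C * q)) + 4 * (T * K * M) * n)
    ≡ 2 * T * ((K + k) * (q * q)) + (K * (2 * k * (q * q)) + (2 * C * (k * q) + 4 * (T * K * M) * n))
  collect = solve-∀

-- As k (1 + k! s) = k + s (k · k!), it is n - k that is divided by k · k!; hence the hypothesis k ≤
-- n.
decompose : ∀ k n → 1 ≤ k → k ≤ n → ∃₂ λ s r → k * suc (k ! * s) + r ≡ n × r ≤ k * k !
decompose k n 1≤k k≤n = s , r , eq , <⇒≤ (m%n<n (n ∸ k) M)
  where
  M : ℕ
  M = k * k !
  instance
    M≢0 : NonZero M
    M≢0 = m*n≢0 k (k !) ⦃ >-nonZero 1≤k ⦄ ⦃ k !≢0 ⦄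
  s r : ℕ
  s = (n ∸ k) / M
  r = (n ∸ k) % M
  identity : ∀ k f s r → k * suc (f * s) + r ≡ k + (r + s * (k * f))
  identity = solve-∀
  eq : k * suc (k ! * s) + r ≡ n
  eq = trans (identity k (k !) s r) (trans (cong (λ x → k + x) (sym (m≡m%n+[m/n]*n (n ∸ k) M))) (m+[n∸m]≡n k≤n))

-- `d` is the depth of the recursion. Divided by 2^d, the inequality bounds the quadratic excess
-- over n² by K n² / 2^d; `C` depends on k and d but not on n.
upper-bound : ∀ k → 2 ≤ k → ∀ d → let K = k * (k ∸ 1) in
  ∃[ C ] ∀ n → ∃[ H ] LinesAtMost {n} k H × 2 ^ d * (K * numLines H) ≤ 2 ^ d * (n * n) + (K * (n * n) + C * n)
-- At depth 0 the trivial bound of n² lines suffices, so any admissible hypergraph will do; the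
-- minimal one is at hand.
upper-bound k 2≤k zero = 0 , λ n →
  let H , H≤k , _ = proj₁ (proj₂ (minNumLines n k 2≤k)) in H , H≤k , (begin
    1 * (K * numLines H)                ≡⟨ *-identityˡ _ ⟩
    K * numLines H                      ≤⟨ *-monoʳ-≤ K (numLines≤n*n H) ⟩
    K * (n * n)                         ≤⟨ m≤m+n _ _ ⟩
    K * (n * n) + 0 * n                 ≤⟨ m≤n+m _ (1 * (n * n)) ⟩
    1 * (n * n) + (K * (n * n) + 0 * n) ∎)
  where
  open ≤-Reasoning
  K = k * (k ∸ 1)
upper-bound k 2≤k (suc d) with C , bound ← upper-bound k 2≤k d = C₁ + C₂ , step
  where
  open ≤-Reasoning
  K T M C₁ C₂ : ℕ
  K  = k * (k ∸ 1)
  T  = 2 ^ d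
  M  = k * k !
  -- `C₁` is the linear coefficient produced by `extension-bound`. `C₂` pays for n below k, where
  -- there are at most n² ≤ k n lines.
  C₁ = 2 * C + 4 * (T * K * M)
  C₂ = 2 * T * (K * k)

  large : ∀ {n} s r → k * suc (k ! * s) + r ≡ n → r ≤ M →
    ∃[ H ] LinesAtMost {n} k H × 2 * T * (K * numLines H) ≤ 2 * T * (n * n) + (K * (n * n) + (C₁ + C₂) * n)
  large {n} s r refl r≤M with G , G≤k , bound-G ← bound (suc (k ! * s)) = extension , linesAtMost ,
    (begin
      2 * T * (K * numLines extension)
        ≤⟨ extension-bound {T = T} {C = C} {l = numLines G} 2≤k (k*[k∸1]+k≡k*k k) refl r≤M bound-G numLines≤ ⟩
      2 * T * (n * n) + (K * (n * n) + C₁ * n)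
        ≤⟨ +-monoʳ-≤ (2 * T * (n * n)) (+-monoʳ-≤ (K * (n * n)) (*-monoˡ-≤ n (m≤m+n C₁ C₂))) ⟩
      2 * T * (n * n) + (K * (n * n) + (C₁ + C₂) * n) ∎)
    where open Extend (transversalDesign (inverse-mod k s)) (vertexCoords k (suc (k ! * s)) r) G 2≤k G≤k

  step : ∀ n → ∃[ H ] LinesAtMost {n} k H × 2 * T * (K * numLines H) ≤ 2 * T * (n * n) + (K * (n * n) + (C₁ + C₂) * n)
  step n with k ≤? n
  ... | yes k≤n = let s , r , eq , r≤M = decompose k n (≤-trans (s≤s z≤n) 2≤k) k≤n in large s r eq r≤M
  ... | no k≰n = let H , H≤k , _ = proj₁ (proj₂ (minNumLines n k 2≤k)) in H , H≤k , (begin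
    2 * T * (K * numLines H)                          ≤⟨ *-monoʳ-≤ (2 * T) 
      (*-monoʳ-≤ K (≤-trans (numLines≤n*n H) (*-monoˡ-≤ n (≰⇒≥ k≰n)))) ⟩
    2 * T * (K * (k * n))                             ≡⟨ identity T K k n ⟩
    C₂ * n                                            ≤⟨ *-monoˡ-≤ n (m≤n+m C₂ C₁) ⟩
    (C₁ + C₂) * n                                     ≤⟨ m≤n+m _ (K * (n * n)) ⟩
    K * (n * n) + (C₁ + C₂) * n                       ≤⟨ m≤n+m _ (2 * T * (n * n)) ⟩
    2 * T * (n * n) + (K * (n * n) + (C₁ + C₂) * n)   ∎)
    where
    identity : ∀ T K k n → 2 * T * (K * (k * n)) ≡ 2 * T * (K * k) * n
    identity = solve-∀

-- Passage to the limit.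

n<2^n : ∀ n → n < 2 ^ n
n<2^n zero    = s≤s z≤n
n<2^n (suc n) = begin-strict
  suc n               <⟨ s≤s (n<2^n n) ⟩
  1 + 2 ^ n           ≤⟨ +-monoˡ-≤ (2 ^ n) (m^n>0 2 n) ⟩
  2 ^ n + 2 ^ n       ≡⟨ cong (λ x → 2 ^ n + x) (+-identityʳ (2 ^ n)) ⟨
  2 ^ suc n           ∎
  where open ≤-Reasoning

-- There are n + 1 vertices here, and (n + 1)² exceeds N = (n + 1) n by only n + 1. All linear
-- errors together stay below N because n is large, and D K + 1 ≤ T absorbs them along with the
-- quadratic error D K N. Divided out, the conclusion is a K / N < 1 + 1 / D.
eventually-close : ∀ {T C K D a n} → T * (K * a) ≤ T * (suc n * suc n) + (K * (suc n * suc n) + C * suc n) →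
  D * K < T → D * (T + K + C) < n → D * (a * K) < suc D * (suc n * n)
eventually-close {T} {C} {K} {D} {a} {n} bound DK<T big = *-cancelˡ-< T _ _ (begin-strict
  T * (D * (a * K))
    ≡⟨ commute T D a K ⟩
  D * (T * (K * a))
    ≤⟨ *-monoʳ-≤ D bound ⟩
  D * (T * (suc n * suc n) + (K * (suc n * suc n) + C * suc n))
    ≡⟨ collect D T K C n ⟩
  T * (D * N) + (D * K * N + D * (T + K + C) * suc n)
    <⟨ +-monoʳ-< (T * (D * N)) (+-monoʳ-< (D * K * N) (*-monoˡ-< (suc n) big)) ⟩
  T * (D * N) + (D * K * N + n * suc n)
    ≡⟨ regroup T D K n ⟩
  T * (D * N) + suc (D * K) * N
    ≤⟨ +-monoʳ-≤ (T * (D * N)) (*-monoˡ-≤ N DK<T) ⟩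
  T * (D * N) + T * N
    ≡⟨ factor T D N ⟩
  T * (suc D * N) ∎)
  where
  open ≤-Reasoning
  N : ℕ
  N = suc n * n
  commute : ∀ T D a K → T * (D * (a * K)) ≡ D * (T * (K * a))
  commute = solve-∀
  collect : ∀ D T K C n → D * (T * (suc n * suc n) + (K * (suc n * suc n) + C * suc n))
    ≡ T * (D * (suc n * n)) + (D * K * (suc n * n) + D * (T + K + C) * suc n)
  collect = solve-∀
  regroup : ∀ T D K n → T * (D * (suc n * n)) + (D * K * (suc n * n) + n * suc n)
    ≡ T * (D * (suc n * n)) + suc (D * K) * (suc n * n)
  regroup = solve-∀
  factor : ∀ T D N → T * (D * N) + T * N ≡ T * (suc D * N)
  factor = solve-∀

-- Unnormalised fractions keep numerator and denominator explicit, so comparing the ratio with a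
-- bound becomes an inequality of integers.
toℚᵘ-ratio : ∀ a K N → toℚᵘ (fromℕ a *ℚ (K /₀ suc N)) ≃ mkℚᵘ (+ (a * K)) N
toℚᵘ-ratio a K N = ℚᵘ.≃-trans (ℚ.toℚᵘ-homo-* (fromℕ a) (K /₀ suc N)) (ℚᵘ.≃-trans
  (ℚᵘ.*-cong (ℚ.toℚᵘ-fromℚᵘ (mkℚᵘ (+ a) 0)) (ℚ.toℚᵘ-fromℚᵘ (mkℚᵘ (+ K) N)))
  (*≡* (cong₂ ℤ._*_ (sym (ℤ.pos-* a K)) (cong (λ x → + suc x) (sym (+-identityʳ N))))))

∣x-1∣<ε : ∀ {x ε} → 1ℚ ℚ.≤ x → x ℚ.< ε ℚ.+ 1ℚ → ∣ x -ℚ 1ℚ ∣ℚ <ℚ ε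
∣x-1∣<ε {x} {ε} 1≤x x<ε+1 = subst₂ _<ℚ_ (sym (ℚ.0≤p⇒∣p∣≡p (ℚ.+-monoˡ-≤ (ℚ.- 1ℚ) 1≤x)))
  (trans (ℚ.+-assoc ε 1ℚ (ℚ.- 1ℚ)) (ℚ.+-identityʳ ε)) (ℚ.+-monoˡ-< (ℚ.- 1ℚ) x<ε+1)

-- A positive rational is at least the reciprocal of its denominator.
ratio-close : ∀ a K N ε → 0ℚ <ℚ ε → suc N ≤ a * K → ↧ₙ ε * (a * K) < suc (↧ₙ ε) * suc N →
  ∣ fromℕ a *ℚ (K /₀ suc N) -ℚ 1ℚ ∣ℚ <ℚ ε
ratio-close a K N (mkℚ (+ zero) _ _)  (ℚ.*<* (ℤ.+<+ ()))
ratio-close a K N (mkℚ -[1+ _ ] _ _)  (ℚ.*<* ())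
ratio-close a K N ε@(mkℚ (+ suc p) D-1 _) _ lower upper = ∣x-1∣<ε
  (ℚ.toℚᵘ-cancel-≤ (ℚᵘ.≤-respʳ-≃ (ℚᵘ.≃-sym (toℚᵘ-ratio a K N)) (*≤* lowerℤ)))
  (ℚ.toℚᵘ-cancel-< (ℚᵘ.<-respˡ-≃ (ℚᵘ.≃-sym (toℚᵘ-ratio a K N))
    (ℚᵘ.<-respʳ-≃ (ℚᵘ.≃-sym (ℚ.toℚᵘ-homo-+ ε 1ℚ)) (*<* upperℤ))))
  where
  open ≤-Reasoning
  D = suc D-1
  lowerℤ : ℤ.1ℤ ℤ.* + suc N ℤ.≤ + (a * K) ℤ.* ℤ.1ℤ
  lowerℤ = subst₂ ℤ._≤_ (sym (ℤ.*-identityˡ (+ suc N))) (sym (ℤ.*-identityʳ (+ (a * K)))) (ℤ.+≤+ lower)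
  upperℕ : a * K * (D * 1) < (suc p * 1 + 1 * D) * suc N
  upperℕ = begin-strict
    a * K * (D * 1)               ≡⟨ trans (cong (a * K *_) (*-identityʳ D)) (*-comm (a * K) D) ⟩
    D * (a * K)                   <⟨ upper ⟩
    suc D * suc N                 ≤⟨ *-monoˡ-≤ (suc N) (s≤s (m≤n+m D (p * 1))) ⟩
    suc (p * 1 + D) * suc N       ≡⟨ cong (λ x → suc (p * 1 + x) * suc N) (*-identityˡ D) ⟨
    (suc p * 1 + 1 * D) * suc N   ∎
  upperℤ : + (a * K) ℤ.* + (D * 1) ℤ.< (+ suc p ℤ.* + 1 ℤ.+ + 1 ℤ.* + D) ℤ.* + suc N
  upperℤ = subst₂ ℤ._<_ (ℤ.pos-* (a * K) (D * 1))
    (trans (ℤ.pos-* (suc p * 1 + 1 * D) (suc N))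
      (cong (ℤ._* + suc N) (cong₂ ℤ._+_ (ℤ.pos-* (suc p) 1) (ℤ.pos-* 1 D)))) (ℤ.+<+ upperℕ)

min-close : ∀ {k n l T C ε} → 0ℚ <ℚ ε → let K = k * (k ∸ 1) in IsMinNumLines (suc (suc n)) k l →
  (∃[ H ] LinesAtMost {suc (suc n)} k H ×
    T * (K * numLines H) ≤ T * (suc (suc n) * suc (suc n)) + (K * (suc (suc n) * suc (suc n)) + C * suc (suc n))) →
  ↧ₙ ε * K < T → ↧ₙ ε * (T + K + C) < suc n →
  ∣ fromℕ l *ℚ (K /₀ (suc (suc n) * suc n)) -ℚ 1ℚ ∣ℚ <ℚ ε
min-close {k} {n} {l} {T} {C} {ε} 0<ε ((H₀ , H₀≤k , refl) , least) (H , H≤k , bound) DK<T big =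
  -- The third argument is chosen so that its successor is (n + 2)(n + 1) by computation. The lower
  -- bound is used on the minimal `H₀`, the upper one on the constructed `H`, and minimality links
  -- them.
  ratio-close l K (n + suc n * suc n) ε 0<ε (numLines-lower H₀ H₀≤k)
    (eventually-close {T} {C} {K} {↧ₙ ε} {l} (≤-trans (*-monoʳ-≤ T (*-monoʳ-≤ K (least H H≤k))) bound) DK<T big)
  where
  K : ℕ
  K = k * (k ∸ 1)

theorem6 : ∀ (k : ℕ) (2≤k : 2 ≤ k) →
    (λ n → fromℕ (m n k 2≤k) *ℚ ((k * (k ∸ 1)) /₀ (n * (n ∸ 1)))) ⟶ 1ℚ
theorem6 k 2≤k ε 0<ε = limit (upper-bound k 2≤k (D * K))
  where
  D K T : ℕ
  D = ↧ₙ ε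
  K = k * (k ∸ 1)
  -- By `n<2^n` this gives D K < T, so the relative quadratic error K / T is below 1 / D, which is
  -- at most ε.
  T = 2 ^ (D * K)
  limit : (∃[ C ] ∀ n → ∃[ H ] LinesAtMost {n} k H × T * (K * numLines H) ≤ T * (n * n) + (K * (n * n) + C * n)) →
    ∃[ N ] ∀ n → N ≤ n → ∣ fromℕ (m n k 2≤k) *ℚ (K /₀ (n * (n ∸ 1))) -ℚ 1ℚ ∣ℚ <ℚ ε
  -- The two successors exclude n ≤ 1, where the quotient has its default value 0, and make n - 1
  -- exceed D (T + K + C).
  limit (C , bound) = suc (suc (D * (T + K + C))) , λ where
    (suc (suc n)) (s≤s big) → min-close {T = T} {C = C} 0<ε
      (proj₂ (minNumLines (suc (suc n)) k 2≤k)) (bound (suc (suc n))) (n<2^n (D * K)) big
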